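{- For every integer $r\ge 3$ there is a constant $c_r$ such that for every graph $G$ with $m$ edges and no isolated vertices, \[ r(K_r,G)\le c_r\, m^{\frac{r-1}{2}}. \]
   Context: For graphs $H$ and $G$, the Ramsey number $r(H,G)$ is the least positive integer $N$ such that every red/blue coloring of the edges of the complete graph $K_N$ contains a red copy of $H$ or a blue copy of $G$. $K_r$ denotes the complete graph on $r$ vertices. -}

module Defs where

open import Data.Nat using (ℕ; zero; suc; _+_; _*_; _^_; _≤_; _<_; _<ᵇ_)
open import Data.Bool using (Bool; true; false; _∧_; if_then_else_)
open import Data.Fin using (Fin; toℕ)
open import Data.List using (List; map; allFin; concatMap)
open import Data.Nat.ListAction using (sum)
open import Data.Product using (Σ; _×_; ∃-syntax)
open import Data.Sum using (_⊎_)
open import Relation.Binary.PropositionalEquality using (_≡_; _≢_)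
open import Relation.Nullary using (¬_)
open import Function.Definitions using (Injective)

record SimpleGraph (n : ℕ) : Set where
  field
    adj     : Fin n → Fin n → Bool
    sym     : ∀ i j → adj i j ≡ adj j i
    irrefl  : ∀ i → adj i i ≡ false
open SimpleGraph public

edgeCount : ∀ {n} → SimpleGraph n → ℕ
edgeCount {n} G =
  sum (concatMap (λ i → map (λ j → if (toℕ i <ᵇ toℕ j) ∧ adj G i j then 1 else 0)
                               (allFin n))
                 (allFin n))

NoIsolated : ∀ {n} → SimpleGraph n → Set
NoIsolated {n} G = ∀ (v : Fin n) → ∃[ u ] adj G v u ≡ true

data Colour : Set where
  red blue : Colour

-- A red/blue colouring of the edges of K_N (symmetric; diagonal irrelevant).
record Colouring (N : ℕ) : Set where
  field
    col    : Fin N → Fin N → Colour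
    colSym : ∀ i j → col i j ≡ col j i
open Colouring public

RedClique : ∀ {N} → Colouring N → ℕ → Set
RedClique {N} c r =
  Σ (Fin r → Fin N) λ f → Injective _≡_ _≡_ f ×
    (∀ i j → i ≢ j → col c (f i) (f j) ≡ red)

BlueCopy : ∀ {N n} → Colouring N → SimpleGraph n → Set
BlueCopy {N} {n} c G =
  Σ (Fin n → Fin N) λ f → Injective _≡_ _≡_ f ×
    (∀ i j → adj G i j ≡ true → col c (f i) (f j) ≡ blue)

Arrows : ℕ → ℕ → ∀ {n} → SimpleGraph n → Set
Arrows N r G = (c : Colouring N) → RedClique c r ⊎ BlueCopy c G

IsRamseyNumber : ℕ → ∀ {n} → SimpleGraph n → ℕ → Set
IsRamseyNumber r G N =
  1 ≤ N × Arrows N r G × (∀ M → 1 ≤ M → M < N → ¬ Arrows M r G)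

{-# OPTIONS --safe #-}

-- Let v be a vertex of minimum degree δ in G, on n vertices. If a colouring of K_N has a blue copy
-- of G − v that does not extend to G, every vertex outside the copy sends a red edge to one of the δ
-- vertices that v must be joined to. So one of those has a large red neighbourhood, and
--   r(K_{k+1}, G) ≤ max (r(K_{k+1}, G − v), n + δ r(K_k, G)).
-- Since δ n ≤ 2m, this gives r(K_3, G) ≤ n + 4m from r(K_2, G) ≤ 2n; since δ² ≤ 2m, each further
-- step costs a factor of order √m.

module Submission where

open import Defs
open import Data.Nat using (ℕ; _*_; _^_; _≤_; _∸_)
open import Data.Product using (∃-syntax)

import Algebra.Properties.CommutativeMonoid.Sum as Sum
open import Data.Bool using (Bool; T; true; false; _∧_; if_then_else_)
import Data.Bool.Properties as Bool
open import Data.Fin using (Fin; zero; suc; toℕ; punchIn; inject≤)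
import Data.Fin.Properties as Fin
open import Data.List using (List; []; _∷_; length; filter; map; allFin; concatMap; tabulate; lookup)
import Data.List.Properties as List
open import Data.List.Membership.Propositional using (_∈_)
open import Data.List.Membership.Propositional.Properties
  using (∈-filter⁺; ∈-filter⁻; ∈-allFin; ∈-lookup)
import Data.List.Relation.Unary.All as All
open import Data.List.Relation.Unary.AllPairs using ([]; _∷_)
open import Data.List.Relation.Unary.Any using (here; there)
open import Data.List.Relation.Unary.Unique.Propositional using (Unique)
open import Data.List.Relation.Unary.Unique.Propositional.Properties using (filter⁺; allFin⁺)
import Data.Nat.ListAction as ListAction
open import Data.Nat.ListAction.Properties using (sum-++)
open import Data.Nat using (zero; suc; _+_; _<_; _<ᵇ_; z≤n; s≤s; >-nonZero; _≤?_)
open import Data.Nat.Properties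
open import Data.Nat.Tactic.RingSolver using (solve-∀)
open import Data.Product using (Σ; _×_; _,_; proj₁; proj₂)
open import Data.Sum using (_⊎_; inj₁; inj₂)
open import Data.Vec.Functional using (insertAt; removeAt; tail)
open import Data.Vec.Functional.Properties using (insertAt-lookup; insertAt-punchIn)
open import Function using (_∘_; id)
open import Function.Definitions using (Injective)
open import Relation.Binary.PropositionalEquality as ≡
  using (_≡_; _≢_; refl; cong; cong₂; subst; subst₂; trans)
open import Relation.Nullary using (¬_; Dec; yes; no; contradiction)
open import Relation.Nullary.Decidable using (¬?; does)
open import Relation.Unary using (Decidable)

open Sum +-0-commutativeMonoid using (sum; sum-syntax; sum-remove; ∑-distrib-+; ∑-comm; sum-cong-≗)

-- Finite sums

sum-mono-≤ : ∀ {n} {f g : Fin n → ℕ} → (∀ i → f i ≤ g i) → sum f ≤ sum g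
sum-mono-≤ {zero}  f≤g = z≤n
sum-mono-≤ {suc n} f≤g = +-mono-≤ (f≤g zero) (sum-mono-≤ (f≤g ∘ suc))

≤-sum : ∀ {n} (t : Fin n → ℕ) i → t i ≤ sum t
≤-sum {suc n} t i = ≤-trans (m≤m+n _ _) (≤-reflexive (≡.sym (sum-remove {i = i} t)))

sum-ones : ∀ n → ∑[ i < n ] 1 ≡ n
sum-ones zero    = refl
sum-ones (suc n) = cong suc (sum-ones n)

sum-removeAt-≤ : ∀ {n} (t : Fin (suc n) → ℕ) i → sum (removeAt t i) ≤ sum t
sum-removeAt-≤ t i = ≤-trans (m≤n+m _ (t i)) (≤-reflexive (≡.sym (sum-remove {i = i} t)))

-- By induction, the smaller of `t zero` and the entry found in the tail works. Applied to degrees,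
-- it gives the vertex `v` with `degree v` times the order at most the degree sum.
∃-≤average : ∀ {n} (t : Fin (suc n) → ℕ) → ∃[ i ] t i * suc n ≤ sum t
∃-≤average {zero}  t = zero , ≤-reflexive (trans (*-identityʳ _) (≡.sym (+-identityʳ _)))
∃-≤average {suc n} t with ∃-≤average (tail t)
... | i , avg with ≤-total (t zero) (t (suc i))
...   | inj₁ t₀≤tᵢ = zero , (begin
  t zero * suc (suc n)             ≡⟨ *-suc (t zero) (suc n) ⟩
  t zero + t zero * suc n          ≤⟨ +-monoʳ-≤ (t zero) (*-monoˡ-≤ (suc n) t₀≤tᵢ) ⟩
  t zero + t (suc i) * suc n       ≤⟨ +-monoʳ-≤ (t zero) avg ⟩
  sum t                            ∎)
  where open ≤-Reasoning
...   | inj₂ tᵢ≤t₀ = suc i , (begin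
  t (suc i) * suc (suc n)          ≡⟨ *-suc (t (suc i)) (suc n) ⟩
  t (suc i) + t (suc i) * suc n    ≤⟨ +-mono-≤ tᵢ≤t₀ avg ⟩
  sum t                            ∎)
  where open ≤-Reasoning

list-sum-tabulate : ∀ {A : Set} {n} (g : A → ℕ) (f : Fin n → A) →
                    ListAction.sum (map g (tabulate f)) ≡ sum (g ∘ f)
list-sum-tabulate {n = zero}  g f = refl
list-sum-tabulate {n = suc n} g f = cong (g (f zero) +_) (list-sum-tabulate g (f ∘ suc))

list-sum-concatMap : ∀ {A : Set} (f : A → List ℕ) xs →
                     ListAction.sum (concatMap f xs) ≡ ListAction.sum (map (ListAction.sum ∘ f) xs)
list-sum-concatMap f []       = refl
list-sum-concatMap f (x ∷ xs) =
  trans (sum-++ (f x) _) (cong (ListAction.sum (f x) +_) (list-sum-concatMap f xs))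

-- Degrees

indicator : Bool → ℕ
indicator b = if b then 1 else 0

indicator≤1 : ∀ b → indicator b ≤ 1
indicator≤1 true  = ≤-refl
indicator≤1 false = z≤n

length-filter-tabulate : ∀ {A : Set} {n} (p : A → Bool) (f : Fin n → A) →
  length (filter (λ a → p a Bool.≟ true) (tabulate f)) ≡ ∑[ i < n ] indicator (p (f i))
length-filter-tabulate {n = zero}  p f = refl
length-filter-tabulate {n = suc n} p f with p (f zero)
... | true  = cong suc (length-filter-tabulate p (f ∘ suc))
... | false = length-filter-tabulate p (f ∘ suc)

module _ {n} (G : SimpleGraph n) where

  degree : Fin n → ℕ
  degree i = ∑[ j < n ] indicator (adj G i j)

  degreeSum : ℕ
  degreeSum = sum degree

  degree≤order : ∀ v → degree v ≤ n
  degree≤order v = ≤-trans (sum-mono-≤ (λ j → indicator≤1 (adj G v j))) (≤-reflexive (sum-ones n))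

  increasingEdge : Fin n → Fin n → ℕ
  increasingEdge i j = indicator ((toℕ i <ᵇ toℕ j) ∧ adj G i j)

  edgeCount≡∑ : edgeCount G ≡ ∑[ i < n ] ∑[ j < n ] increasingEdge i j
  edgeCount≡∑ = trans (list-sum-concatMap row (allFin n))
    (trans (list-sum-tabulate {n = n} (ListAction.sum ∘ row) id)
           (sum-cong-≗ {n} λ i → list-sum-tabulate (increasingEdge i) id))
    where
    row : Fin n → List ℕ
    row i = map (increasingEdge i) (allFin n)

  -- Either `i` and `j` are strictly ordered one way, and that term counts the edge, or they
  -- coincide and `irrefl` makes the left side zero.
  indicator-adj-≤ : ∀ i j → indicator (adj G i j) ≤ increasingEdge i j + increasingEdge j i
  indicator-adj-≤ i j with toℕ i <ᵇ toℕ j in i<j | toℕ j <ᵇ toℕ i in j<i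
  ... | true  | _    = m≤m+n _ _
  ... | false | true = ≤-reflexive (cong indicator (sym G i j))
  ... | false | false
    with Fin.toℕ-injective {i = i} {j} (≤-antisym (≮⇒≥ (λ lt → subst T j<i (<⇒<ᵇ lt)))
                                                     (≮⇒≥ (λ lt → subst T i<j (<⇒<ᵇ lt))))
  ... | refl = ≤-reflexive (cong indicator (irrefl G i))

  -- One half of the handshake identity: each adjacency is charged to its increasing pair, and
  -- exchanging the order of summation turns the second double sum into the first.
  degreeSum≤2edgeCount : degreeSum ≤ edgeCount G + edgeCount G
  degreeSum≤2edgeCount = begin
    degreeSum
      ≤⟨ sum-mono-≤ (λ i → sum-mono-≤ (indicator-adj-≤ i)) ⟩
    ∑[ i < n ] ∑[ j < n ] (e i j + e j i)
      ≡⟨ sum-cong-≗ {n} (λ i → ∑-distrib-+ (e i) (λ j → e j i)) ⟩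
    ∑[ i < n ] (∑[ j < n ] e i j + ∑[ j < n ] e j i)
      ≡⟨ ∑-distrib-+ (λ i → ∑[ j < n ] e i j) (λ i → ∑[ j < n ] e j i) ⟩
    ∑[ i < n ] ∑[ j < n ] e i j + ∑[ i < n ] ∑[ j < n ] e j i
      ≡⟨ cong (∑[ i < n ] ∑[ j < n ] e i j +_) (∑-comm (λ i j → e j i)) ⟩
    ∑[ i < n ] ∑[ j < n ] e i j + ∑[ i < n ] ∑[ j < n ] e i j
      ≡⟨ cong₂ _+_ edgeCount≡∑ edgeCount≡∑ ⟨
    edgeCount G + edgeCount G ∎
    where
    open ≤-Reasoning
    e = increasingEdge

  -- Every degree is at least 1. With the handshake bound this yields `n ≤ 2m`, so the final
  -- estimate can be stated in `m` alone.
  order≤degreeSum : NoIsolated G → n ≤ degreeSum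
  order≤degreeSum noIsolated = subst (_≤ degreeSum) (sum-ones n) (sum-mono-≤ λ v →
    let u , vu = noIsolated v in
    ≤-trans (≤-reflexive (≡.sym (cong indicator vu))) (≤-sum (λ j → indicator (adj G v j)) u))

-- Deleting a vertex

deleteVertex : ∀ {n} → SimpleGraph (suc n) → Fin (suc n) → SimpleGraph n
deleteVertex G v = record
  { adj    = λ i j → adj G (punchIn v i) (punchIn v j)
  ; sym    = λ i j → sym G (punchIn v i) (punchIn v j)
  ; irrefl = λ i → irrefl G (punchIn v i)
  }

degreeSum-deleteVertex : ∀ {n} (G : SimpleGraph (suc n)) v →
                         degreeSum (deleteVertex G v) ≤ degreeSum G
degreeSum-deleteVertex G v =
  ≤-trans (sum-mono-≤ λ i → sum-removeAt-≤ (λ j → indicator (adj G (punchIn v i) j)) v) (sum-removeAt-≤ (degree G) v)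

-- Listed by their indices in `deleteVertex G v`, the domain of the blue copy that is to be
-- extended.
neighbours : ∀ {n} → SimpleGraph (suc n) → Fin (suc n) → List (Fin n)
neighbours {n} G v = filter (λ u → adj G v (punchIn v u) Bool.≟ true) (allFin n)

length-neighbours : ∀ {n} (G : SimpleGraph (suc n)) v → length (neighbours G v) ≤ degree G v
length-neighbours G v =
  ≤-trans (≤-reflexive (length-filter-tabulate (λ u → adj G v (punchIn v u)) id))
          (sum-removeAt-≤ (λ j → indicator (adj G v j)) v)

-- Duplicate-free lists

lookup-injective : ∀ {A : Set} {xs : List A} → Unique xs → Injective _≡_ _≡_ (lookup xs)
lookup-injective (_ ∷ _)      {zero}  {zero}  _  = refl
lookup-injective (x∉ ∷ _)     {zero}  {suc j} eq = contradiction eq (All.lookup x∉ (∈-lookup j))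
lookup-injective (x∉ ∷ _)     {suc i} {zero}  eq = contradiction (≡.sym eq) (All.lookup x∉ (∈-lookup i))
lookup-injective (_ ∷ unique) {suc i} {suc j} eq = cong suc (lookup-injective unique eq)

length-filter-∁ : ∀ {A : Set} {P : A → Set} (P? : Decidable P) xs →
                  length xs ≡ length (filter P? xs) + length (filter (¬? ∘ P?) xs)
length-filter-∁ P? []       = refl
length-filter-∁ P? (x ∷ xs) with does (P? x)
... | true  = cong suc (length-filter-∁ P? xs)
... | false = trans (cong suc (length-filter-∁ P? xs)) (≡.sym (+-suc _ _))

-- Going through `us`, each `u` strikes out the remaining elements that satisfy `P u`. Either some
-- `u` strikes out more than `K` at once, or at most `length us * K` are lost in total and the
-- survivors avoid every `P u`.
sieve : ∀ {A B : Set} {P : B → A → Set} (P? : ∀ u → Decidable (P u)) K us {xs} → Unique xs →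
  (∃[ u ] u ∈ us × ∃[ ys ] Unique ys × K < length ys × (∀ {y} → y ∈ ys → y ∈ xs × P u y)) ⊎
  (∃[ ys ] Unique ys × length xs ≤ length ys + length us * K ×
           (∀ {y} → y ∈ ys → y ∈ xs × (∀ {u} → u ∈ us → ¬ P u y)))
sieve P? K [] {xs} unique =
  inj₂ (xs , unique , ≤-reflexive (≡.sym (+-identityʳ _)) , λ y∈ → y∈ , λ ())
sieve P? K (u ∷ us) {xs} unique with length (filter (P? u) xs) ≤? K
... | no ≰K = inj₁ (u , here refl , _ , filter⁺ (P? u) unique , ≰⇒> ≰K , ∈-filter⁻ (P? u))
... | yes ≤K with sieve P? K us (filter⁺ (¬? ∘ P? u) unique)
...   | inj₁ (w , w∈us , ys , unique′ , K< , ys⊆) =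
  inj₁ (w , there w∈us , ys , unique′ , K< , λ y∈ →
    proj₁ (∈-filter⁻ (¬? ∘ P? u) (proj₁ (ys⊆ y∈))) , proj₂ (ys⊆ y∈))
...   | inj₂ (ys , unique′ , bound , ys⊆) = inj₂ (ys , unique′ , bound′ , λ y∈ →
    let y∈xs , ¬Py = ∈-filter⁻ (¬? ∘ P? u) (proj₁ (ys⊆ y∈)) in
    y∈xs , λ { (here refl) → ¬Py ; (there w∈) → proj₂ (ys⊆ y∈) w∈ })
  where
  open ≤-Reasoning
  rearrange : ∀ a b c → a + (b + c) ≡ b + (a + c)
  rearrange = solve-∀
  bound′ : length xs ≤ length ys + (K + length us * K)
  bound′ = begin
    length xs                                                  ≡⟨ length-filter-∁ (P? u) xs ⟩
    length (filter (P? u) xs) + length (filter (¬? ∘ P? u) xs) ≤⟨ +-mono-≤ ≤K bound ⟩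
    K + (length ys + length us * K)                            ≡⟨ rearrange K (length ys) _ ⟩
    length ys + (K + length us * K)                            ∎

-- Colourings

pullback : ∀ {M N} → (Fin M → Fin N) → Colouring N → Colouring M
pullback e c = record { col = λ i j → col c (e i) (e j) ; colSym = λ i j → colSym c (e i) (e j) }

-- The red case records that the clique lies in the image of `e`, so that a vertex joined in red to
-- that whole image can be added to it.
arrows-pullback : ∀ {M N r n} (G : SimpleGraph n) (e : Fin M → Fin N) → Injective _≡_ _≡_ e →
  Arrows M r G → (c : Colouring N) →
  (Σ (RedClique c r) λ R → ∀ i → ∃[ j ] proj₁ R i ≡ e j) ⊎ BlueCopy c G
arrows-pullback G e e-inj arrows c with arrows (pullback e c)
... | inj₁ (f , f-inj , isRed)  = inj₁ ((e ∘ f , f-inj ∘ e-inj , isRed) , λ i → f i , refl)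
... | inj₂ (f , f-inj , isBlue) = inj₂ (e ∘ f , f-inj ∘ e-inj , isBlue)

arrows-mono : ∀ {M N r n} (G : SimpleGraph n) → M ≤ N → Arrows M r G → Arrows N r G
arrows-mono G M≤N arrows c
  with arrows-pullback G (λ i → inject≤ i M≤N) (Fin.inject≤-injective M≤N M≤N _ _) arrows c
... | inj₁ (R , _) = inj₁ R
... | inj₂ B       = inj₂ B

_≟ᶜ_ : (a b : Colour) → Dec (a ≡ b)
red  ≟ᶜ red  = yes refl
red  ≟ᶜ blue = no λ ()
blue ≟ᶜ red  = no λ ()
blue ≟ᶜ blue = yes refl

≢red⇒blue : ∀ {a} → a ≢ red → a ≡ blue
≢red⇒blue {red}  a≢red = contradiction refl a≢red
≢red⇒blue {blue} _     = refl

-- Extending red cliques and blue copies by a vertex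

extendClique : ∀ {N r} (c : Colouring N) x (R : RedClique c r) →
  (∀ i → x ≢ proj₁ R i) → (∀ i → col c x (proj₁ R i) ≡ red) → RedClique c (suc r)
extendClique {N} {r} c x (f , f-inj , isRed) fresh joined = g , g-inj , isRed′
  where
  g : Fin (suc r) → Fin N
  g zero    = x
  g (suc i) = f i
  g-inj : Injective _≡_ _≡_ g
  g-inj {zero}  {zero}  _  = refl
  g-inj {zero}  {suc j} eq = contradiction eq (fresh j)
  g-inj {suc i} {zero}  eq = contradiction (≡.sym eq) (fresh i)
  g-inj {suc i} {suc j} eq = cong suc (f-inj eq)
  isRed′ : ∀ i j → i ≢ j → col c (g i) (g j) ≡ red
  isRed′ zero    zero    i≢j = contradiction refl i≢j
  isRed′ zero    (suc j) _   = joined j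
  isRed′ (suc i) zero    _   = trans (colSym c _ _) (joined i)
  isRed′ (suc i) (suc j) i≢j = isRed i j (i≢j ∘ cong suc)

-- Separates `v` from the vertices of `G − v`; matching puts an index into the form to which the
-- equations for `insertAt` apply.
data PunchInView {n} (v : Fin (suc n)) : Fin (suc n) → Set where
  hole    : PunchInView v v
  punched : ∀ i → PunchInView v (punchIn v i)

punchInView : ∀ {n} (v i : Fin (suc n)) → PunchInView v i
punchInView v i with v Fin.≟ i
... | yes refl = hole
... | no v≢i   = subst (PunchInView v) (Fin.punchIn-punchOut v≢i) (punched _)

extendCopy : ∀ {N n} (c : Colouring N) (G : SimpleGraph (suc n)) v
  (B : BlueCopy c (deleteVertex G v)) w →
  (∀ u → w ≢ proj₁ B u) → (∀ u → adj G v (punchIn v u) ≡ true → col c w (proj₁ B u) ≡ blue) →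
  BlueCopy c G
extendCopy {N} {n} c G v (f , f-inj , isBlue) w fresh joined = g , g-inj , isBlue′
  where
  g : Fin (suc n) → Fin N
  g = insertAt f v w
  g-hole : g v ≡ w
  g-hole = insertAt-lookup f v w
  g-punched : ∀ i → g (punchIn v i) ≡ f i
  g-punched = insertAt-punchIn f v w
  g-inj : Injective _≡_ _≡_ g
  g-inj {i} {j} eq with punchInView v i | punchInView v j
  ... | hole      | hole      = refl
  ... | hole      | punched j = contradiction (trans (≡.sym g-hole) (trans eq (g-punched j))) (fresh j)
  ... | punched i | hole      =
    contradiction (trans (≡.sym g-hole) (trans (≡.sym eq) (g-punched i))) (fresh i)
  ... | punched i | punched j =
    cong (punchIn v) (f-inj (trans (≡.sym (g-punched i)) (trans eq (g-punched j))))
  isBlue′ : ∀ i j → adj G i j ≡ true → col c (g i) (g j) ≡ blue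
  isBlue′ i j ij with punchInView v i | punchInView v j
  ... | hole      | hole      = contradiction (trans (≡.sym ij) (irrefl G v)) λ ()
  ... | hole      | punched j rewrite g-hole | g-punched j = joined j ij
  ... | punched i | hole      rewrite g-hole | g-punched i =
    trans (colSym c _ _) (joined i (trans (sym G v (punchIn v i)) ij))
  ... | punched i | punched j rewrite g-punched i | g-punched j = isBlue i j ij

-- Given a blue copy of `G − v`, the vertices outside it are sieved by the red neighbourhoods of the
-- images of the neighbours of `v`. A survivor can play the role of `v`. Otherwise one image has
-- more than `K` red neighbours outside the copy, and `arrows` finds there a blue `G` or a red
-- clique that this image enlarges.
arrows-deleteVertex : ∀ {n K N r} (G : SimpleGraph (suc n)) v → suc n + degree G v * K ≤ N →
  Arrows K r G → Arrows N (suc r) (deleteVertex G v) → Arrows N (suc r) G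
arrows-deleteVertex {n} {K} {N} {r} G v large arrows arrows′ c with arrows′ c
... | inj₁ R = inj₁ R
-- This sieve discards the copy itself. Only one vertex equals `f u`, so the threshold 1 is never
-- exceeded and at least `N − n` vertices remain.
... | inj₂ B@(f , _) with sieve (λ u w → w Fin.≟ f u) 1 (allFin n) (allFin⁺ N)
...   | inj₁ (u , _ , x ∷ y ∷ _ , (x∉ ∷ _) , _ , ⊆f) =
  contradiction (trans (proj₂ (⊆f (here refl))) (≡.sym (proj₂ (⊆f (there (here refl))))))
                (All.lookup x∉ (here refl))
...   | inj₁ (u , _ , x ∷ [] , _ , s≤s () , _)
...   | inj₂ (outside , outside! , bound₁ , ⊆outside)
  with sieve (λ u w → col c (f u) w ≟ᶜ red) K (neighbours G v) outside!
-- With no survivor the two sieve bounds give `N ≤ n + degree G v * K`, one less than `large`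
-- demands.
...     | inj₂ ([] , _ , bound₂ , _) = contradiction tooSmall (<⇒≱ ≤-refl)
  where
  open ≤-Reasoning
  tooSmall : suc n + degree G v * K ≤ n + degree G v * K
  tooSmall = begin
    suc n + degree G v * K                   ≤⟨ large ⟩
    N                                        ≡⟨ List.length-tabulate id ⟨
    length (allFin N)                        ≤⟨ bound₁ ⟩
    length outside + length (allFin n) * 1   ≡⟨ cong (length outside +_)
                                                  (trans (*-identityʳ _) (List.length-tabulate id)) ⟩
    length outside + n                       ≤⟨ +-monoˡ-≤ n bound₂ ⟩
    length (neighbours G v) * K + n          ≤⟨ +-monoˡ-≤ n (*-monoˡ-≤ K (length-neighbours G v)) ⟩
    degree G v * K + n                       ≡⟨ +-comm _ n ⟩
    n + degree G v * K                       ∎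
...     | inj₂ (w ∷ _ , _ , _ , ⊆free) = inj₂ (extendCopy c G v B w
  (λ u → proj₂ (⊆outside (proj₁ (⊆free (here refl)))) (∈-allFin u))
  (λ u vu → ≢red⇒blue λ wu → proj₂ (⊆free (here refl)) (∈-filter⁺ _ (∈-allFin u) vu)
                                   (trans (colSym c _ _) wu)))
-- The first `K` entries of `ys` carry a copy of `K_K` inside the red neighbourhood of `f u`; they
-- lie outside the copy, hence differ from `f u`.
...     | inj₁ (u , _ , ys , ys! , K<ys , ⊆ys)
  with arrows-pullback G e (Fin.inject≤-injective _ _ _ _ ∘ lookup-injective ys!) arrows c
  where
  e : Fin K → Fin N
  e i = lookup ys (inject≤ i (<⇒≤ K<ys))
...       | inj₂ B′       = inj₂ B′
...       | inj₁ (R , ⊆e) = inj₁ (extendClique c (f u) R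
  (λ i eq → proj₂ (⊆outside (proj₁ (inYs i))) (∈-allFin u) (≡.sym eq))
  (λ i → proj₂ (inYs i)))
  where
  inYs : ∀ i → proj₁ R i ∈ outside × col c (f u) (proj₁ R i) ≡ red
  inYs i = ⊆ys (subst (_∈ ys) (≡.sym (proj₂ (⊆e i))) (∈-lookup _))

-- Iterating over the clique size

-- Deleting a vertex can create isolated vertices but cannot raise the degree sum, so the induction
-- carries a bound on the latter.
ArrowsBelow : ℕ → ℕ → (ℕ → ℕ) → Set
ArrowsBelow D r B = ∀ {n} (G : SimpleGraph n) → degreeSum G ≤ D → Arrows (B n) r G

-- Induction on the order, deleting a vertex of at most average degree `d`; `d ≤ n` and `d * n ≤ D`
-- are what is known of it. Monotonicity of `B′` carries the result for the smaller graph up to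
-- `B′ (suc n)`. The graph without vertices has the empty blue copy.
arrowsBelow-suc : ∀ {D r B B′} → ArrowsBelow D r B → (∀ n → B′ n ≤ B′ (suc n)) →
  (∀ n d → d ≤ n → d * n ≤ D → n + d * B n ≤ B′ n) → ArrowsBelow D (suc r) B′
arrowsBelow-suc arrows mono bound {zero}  G G≤D c = inj₂ ((λ ()) , (λ { {()} }) , λ ())
arrowsBelow-suc arrows mono bound {suc n} G G≤D =
  let v , avg = ∃-≤average (degree G) in
  arrows-deleteVertex G v (bound (suc n) (degree G v) (degree≤order G v) (≤-trans avg G≤D))
    (arrows G G≤D)
    (arrows-mono (deleteVertex G v) (mono n) (arrowsBelow-suc arrows mono bound (deleteVertex G v)
      (≤-trans (degreeSum-deleteVertex G v) G≤D)))

-- Bounds r(K_{k+1}, G) when G has n vertices and degree sum at most D, with s = ⌊√D⌋.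
ramseyBound : ℕ → ℕ → ℕ → ℕ → ℕ
ramseyBound D s 0             n = 1
ramseyBound D s 1             n = n + n
ramseyBound D s 2             n = n + (D + D)
ramseyBound D s (suc (suc (suc k))) n = n + s * ramseyBound D s (suc (suc k)) n

ramseyBound-mono : ∀ D s k n → ramseyBound D s k n ≤ ramseyBound D s k (suc n)
ramseyBound-mono D s 0 n = ≤-refl
ramseyBound-mono D s 1 n = +-mono-≤ (n≤1+n n) (n≤1+n n)
ramseyBound-mono D s 2 n = n≤1+n _
ramseyBound-mono D s (suc (suc (suc k))) n =
  +-mono-≤ (n≤1+n n) (*-monoʳ-≤ s (ramseyBound-mono D s (suc (suc k)) n))

order≤ramseyBound : ∀ D s k n → n ≤ ramseyBound D s (suc k) n
order≤ramseyBound D s 0             n = m≤m+n _ _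
order≤ramseyBound D s 1             n = m≤m+n _ _
order≤ramseyBound D s (suc (suc k)) n = m≤m+n _ _

-- For `k = 1` the product `d * (n + n)` is bounded through `d * n ≤ D`, which keeps it linear in
-- `D`; using `d ≤ s` there would cost a further factor of order `√D`. From `k = 2` on,
-- `d * d ≤ d * n ≤ D` gives `d ≤ s`.
ramseyBound-step : ∀ {D s} → (∀ d → d * d ≤ D → d ≤ s) → ∀ k n d → d ≤ n → d * n ≤ D →
                   n + d * ramseyBound D s k n ≤ ramseyBound D s (suc k) n
ramseyBound-step s-max 0 n d d≤n dn≤D = +-monoʳ-≤ n (≤-trans (≤-reflexive (*-identityʳ d)) d≤n)
ramseyBound-step s-max 1 n d d≤n dn≤D =
  +-monoʳ-≤ n (≤-trans (≤-reflexive (*-distribˡ-+ d n n)) (+-mono-≤ dn≤D dn≤D))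
ramseyBound-step s-max (suc (suc k)) n d d≤n dn≤D =
  +-monoʳ-≤ n (*-monoˡ-≤ _ (s-max d (≤-trans (*-monoʳ-≤ d d≤n) dn≤D)))

arrowsBelow-ramseyBound : ∀ {D s} → (∀ d → d * d ≤ D → d ≤ s) → ∀ k →
                          ArrowsBelow D (suc k) (ramseyBound D s k)
arrowsBelow-ramseyBound s-max zero    G G≤D c =
  -- The bound is 1 here: a single vertex is a red `K_1`.
  inj₁ ((λ _ → zero) , (λ { {zero} {zero} _ → refl }) , λ { zero zero i≢j → contradiction refl i≢j })
arrowsBelow-ramseyBound {D} {s} s-max (suc k) =
  arrowsBelow-suc (arrowsBelow-ramseyBound s-max k)
                  (ramseyBound-mono D s (suc k)) (ramseyBound-step s-max k)

-- Integer square roots and the final estimate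

∃-sqrt : ∀ D → ∃[ s ] s * s ≤ D × (∀ d → d * d ≤ D → d ≤ s)
∃-sqrt zero = 0 , z≤n , λ { zero _ → z≤n }
∃-sqrt (suc D) with ∃-sqrt D
... | s , s²≤D , s-max with suc s * suc s ≤? suc D
-- By `s-max`, `suc s * suc s` exceeds `D`, so any `d` above `suc s` has a square above `suc D`.
...   | yes larger = suc s , larger , λ d d²≤ → ≮⇒≥ λ s<d → <⇒≱ (begin-strict
  suc D                  ≤⟨ s≤s (≮⇒≥ λ s²<D → 1+n≰n (s-max (suc s) s²<D)) ⟩
  suc s * suc s          <⟨ *-mono-< (n<1+n (suc s)) (n<1+n (suc s)) ⟩
  suc (suc s) * suc (suc s) ≤⟨ *-mono-≤ s<d s<d ⟩
  d * d                  ∎) d²≤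
  where open ≤-Reasoning
...   | no ¬larger = s , m≤n⇒m≤1+n s²≤D , λ d d²≤ →
  ≮⇒≥ λ s<d → ¬larger (≤-trans (*-mono-≤ s<d s<d) d²≤)

-- The two sides differ by `(b − a)²`. Writing `b` as `a + d` turns this into a polynomial identity
-- over the naturals.
square-+-≤-ordered : ∀ {a b} → a ≤ b → (a + b) * (a + b) ≤ 2 * (a * a + b * b)
square-+-≤-ordered {a} {b} a≤b with b ∸ a | m+[n∸m]≡n a≤b
... | d | refl = ≤-trans (m≤m+n _ (d * d)) (≤-reflexive (identity a d))
  where
  identity : ∀ a d → (a + (a + d)) * (a + (a + d)) + d * d ≡ 2 * (a * a + (a + d) * (a + d))
  identity = solve-∀

square-+-≤ : ∀ a b → (a + b) * (a + b) ≤ 2 * (a * a + b * b)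
square-+-≤ a b with ≤-total a b
... | inj₁ a≤b = square-+-≤-ordered a≤b
... | inj₂ b≤a = subst₂ _≤_ (cong (λ x → x * x) (+-comm b a)) (cong (2 *_) (+-comm (b * b) (a * a)))
                        (square-+-≤-ordered b≤a)

-- `constant k` serves the clique size `k + 3`. The start is `6²`, from `n + 4m ≤ 6m`. In the
-- recursion, the factor 2 of `square-+-≤` meets `n² ≤ 4m²` and `s² ≤ 2m`, giving 8 and 4.
constant : ℕ → ℕ
constant zero    = 36
constant (suc k) = 8 + 4 * constant k

-- Squaring clears the half-integer exponent and lets `s` enter only through `s * s ≤ 2m`. The
-- summand `n` of each step is absorbed because `m ≤ m ^ (k + 2)` for positive `m`.
ramseyBound-square : ∀ {m n s} → 1 ≤ m → n ≤ m + m → s * s ≤ m + m → ∀ k →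
  let b = ramseyBound (m + m) s (suc (suc k)) n in b * b ≤ constant k * m ^ (suc (suc k))
ramseyBound-square {m} {n} {s} 1≤m n≤2m s²≤2m zero = begin
  b * b                      ≤⟨ *-mono-≤ b≤6m b≤6m ⟩
  (6 * m) * (6 * m)          ≡⟨ identity m ⟩
  36 * (m * (m * 1))         ∎
  where
  open ≤-Reasoning
  b = n + ((m + m) + (m + m))
  sixfold : ∀ m → (m + m) + ((m + m) + (m + m)) ≡ 6 * m
  sixfold = solve-∀
  b≤6m : b ≤ 6 * m
  b≤6m = ≤-trans (+-monoˡ-≤ _ n≤2m) (≤-reflexive (sixfold m))
  identity : ∀ m → (6 * m) * (6 * m) ≡ 36 * (m * (m * 1))
  identity = solve-∀
ramseyBound-square {m} {n} {s} 1≤m n≤2m s²≤2m (suc k) = begin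
  (n + s * b) * (n + s * b)                            ≤⟨ square-+-≤ n (s * b) ⟩
  2 * (n * n + (s * b) * (s * b))                      ≡⟨ regroup n s b ⟩
  2 * (n * n + (s * s) * (b * b))                      ≤⟨ *-monoʳ-≤ 2 (+-mono-≤ (*-mono-≤ n≤2m n≤2m) (*-mono-≤ s²≤2m b²≤)) ⟩
  2 * ((m + m) * (m + m) + (m + m) * (constant k * p)) ≡⟨ collect m (constant k) p ⟩
  8 * (m * m) + 4 * constant k * (m * p)               ≤⟨ +-monoˡ-≤ _ (*-monoʳ-≤ 8 (*-monoʳ-≤ m m≤p)) ⟩
  8 * (m * p) + 4 * constant k * (m * p)               ≡⟨ *-distribʳ-+ (m * p) 8 (4 * constant k) ⟨
  (8 + 4 * constant k) * (m * p)                       ∎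
  where
  open ≤-Reasoning
  b = ramseyBound (m + m) s (suc (suc k)) n
  p = m ^ suc (suc k)
  b²≤ : b * b ≤ constant k * p
  b²≤ = ramseyBound-square {s = s} 1≤m n≤2m s²≤2m k
  m≤p : m ≤ p
  m≤p = m≤m*n m (m ^ suc k) ⦃ m^n≢0 m (suc k) ⦃ >-nonZero 1≤m ⦄ ⦄
  regroup : ∀ n s b → 2 * (n * n + (s * b) * (s * b)) ≡ 2 * (n * n + (s * s) * (b * b))
  regroup = solve-∀
  collect : ∀ m c p → 2 * ((m + m) * (m + m) + (m + m) * (c * p)) ≡ 8 * (m * m) + 4 * c * (m * p)
  collect = solve-∀

theorem3 : ∀ (r : ℕ) → 3 ≤ r → ∃[ C ] (∀ (n : ℕ) (G : SimpleGraph n) → 1 ≤ n → NoIsolated G →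
    ∀ (N : ℕ) → IsRamseyNumber r G N → N ^ 2 ≤ C * edgeCount G ^ (r ∸ 1))
theorem3 (suc (suc (suc k))) (s≤s (s≤s (s≤s z≤n))) = constant k , bound
  where
  bound : ∀ n (G : SimpleGraph n) → 1 ≤ n → NoIsolated G →
          ∀ N → IsRamseyNumber (suc (suc (suc k))) G N → N ^ 2 ≤ constant k * edgeCount G ^ suc (suc k)
  bound n G 1≤n noIsolated N (_ , _ , N-least) = begin
    N * (N * 1)   ≡⟨ cong (N *_) (*-identityʳ N) ⟩
    N * N         ≤⟨ *-mono-≤ N≤b N≤b ⟩
    b * b         ≤⟨ ramseyBound-square 1≤m n≤2m s²≤2m k ⟩
    constant k * m ^ suc (suc k) ∎
    where
    open ≤-Reasoning
    m = edgeCount G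
    n≤2m : n ≤ m + m
    n≤2m = ≤-trans (order≤degreeSum G noIsolated) (degreeSum≤2edgeCount G)
    -- Without edges `n ≤ 2m` would force `n = 0`.
    1≤m : 1 ≤ m
    1≤m = n≢0⇒n>0 λ m≡0 → <⇒≱ 1≤n (subst (λ m → n ≤ m + m) m≡0 n≤2m)
    sqrt = ∃-sqrt (m + m)
    s = proj₁ sqrt
    s²≤2m = proj₁ (proj₂ sqrt)
    b = ramseyBound (m + m) s (suc (suc k)) n
    N≤b : N ≤ b
    -- Were `b` smaller than `N`, it would be a positive number that arrows `G`, against minimality
    -- of `N`; positivity comes from `1 ≤ n ≤ b`.
    N≤b = ≮⇒≥ λ b<N → N-least b (≤-trans 1≤n (order≤ramseyBound (m + m) s (suc k) n)) b<N
      (arrowsBelow-ramseyBound (proj₂ (proj₂ sqrt)) (suc (suc k)) G (degreeSum≤2edgeCount G))
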